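{- For every integer $r \ge 5$, there exists a graph $F_r$ such that $\mathrm{sat}(n, C_r, F_r) = 0$ for infinitely many values of $n$ and $\mathrm{sat}(n, C_r, F_r) > 0$ for infinitely many values of $n$.
   Context: A graph $G$ is $F$-saturated if $G$ contains no copy of $F$ but adding any edge to $G$ creates a copy of $F$. $\mathrm{sat}(n,H,F)$ is the minimum number of copies of $H$ in an $n$-vertex $F$-saturated graph. $C_r$ is the cycle of length $r$. -}

module Defs where

open import Data.Nat using (ℕ; zero; suc; _≤_; _≡ᵇ_)
open import Data.Fin using (Fin; toℕ; _≟_)
open import Data.Bool using (Bool; true; false; _∧_; _∨_; not; if_then_else_)
open import Data.Product using (Σ; ∃; ∃-syntax; _×_; _,_)
open import Relation.Nullary using (¬_)
open import Relation.Nullary.Decidable using (⌊_⌋)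
open import Relation.Binary.PropositionalEquality using (_≡_; _≢_)
open import Function.Definitions using (Injective)

Graph : ℕ → Set
Graph n = Fin n → Fin n → Bool

IsSimple : ∀ {n} → Graph n → Set
IsSimple {n} G = (∀ (i j : Fin n) → G i j ≡ G j i) × (∀ (i : Fin n) → G i i ≡ false)

Contains : ∀ {n m} → Graph n → Graph m → Set
Contains {n} {m} G H =
  Σ (Fin m → Fin n) λ f → Injective _≡_ _≡_ f ×
    (∀ (a b : Fin m) → H a b ≡ true → G (f a) (f b) ≡ true)

addEdge : ∀ {n} → Graph n → Fin n → Fin n → Graph n
addEdge G u v a b = G a b ∨ (⌊ a ≟ u ⌋ ∧ ⌊ b ≟ v ⌋) ∨ (⌊ a ≟ v ⌋ ∧ ⌊ b ≟ u ⌋)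

Saturated : ∀ {n m} → Graph n → Graph m → Set
Saturated {n} G F =
  ¬ Contains G F ×
  (∀ (u v : Fin n) → u ≢ v → G u v ≡ false → Contains (addEdge G u v) F)

-- The cycle C_r on vertices 0,…,r-1 (i ~ i+1 mod r); for r ≥ 3 this is the r-cycle.
next : (r : ℕ) → Fin r → ℕ
next r i = if suc (toℕ i) ≡ᵇ r then 0 else suc (toℕ i)

cycle : (r : ℕ) → Graph r
cycle r i j = not (toℕ i ≡ᵇ toℕ j) ∧ ((toℕ j ≡ᵇ next r i) ∨ (toℕ i ≡ᵇ next r j))

SatIsZero : (n : ℕ) → ∀ {k m} → Graph k → Graph m → Set
SatIsZero n H F = Σ (Graph n) λ G → IsSimple G × Saturated G F × ¬ Contains G H

-- sat(n, H, F) > 0 : n-vertex F-saturated graphs exist (so sat is defined),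
-- and every one of them contains at least one copy of H.
SatIsPositive : (n : ℕ) → ∀ {k m} → Graph k → Graph m → Set
SatIsPositive n H F =
  (Σ (Graph n) λ G → IsSimple G × Saturated G F) ×
  (∀ (G : Graph n) → IsSimple G → Saturated G F → Contains G H)

InfinitelyMany : (ℕ → Set) → Set
InfinitelyMany P = ∀ (N : ℕ) → ∃[ n ] (N ≤ n × P n)

{-# OPTIONS --safe #-}
-- Put s = r - 1 ≥ 4 and let F be the dumbbell: two disjoint copies of K_s
-- joined by an edge.  A disjoint union of cliques, all of the same size t with
-- s ≤ t < 2s, is F-saturated.  With t = s it contains no C_r, which settles all
-- multiples of s; with t = s + 1 it shows that saturated graphs also exist on
-- some n not divisible by s.
--
-- Conversely a saturated graph without C_r is partitioned into copies of K_s,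
-- so that s divides n.  The tool is that a K_s whose two distinct vertices are
-- joined by a path with one, two or three interior vertices, all outside
-- it, yields a cycle of length exactly s + 1.  For non-adjacent x and y,
-- the dumbbell created by the edge xy provides either two common neighbours of x
-- and y, or disjoint copies of K_s through x and through y.  The first outcome
-- produces such a path if x misses some K_s; the second one puts x into a
-- K_s.  The same dichotomy excludes two different copies of K_s sharing a vertex.
module Submission where

open import Defs
open import Data.Nat using (ℕ; zero; suc; _+_; _*_; _≤_; _<_; z≤n; s≤s; _≡ᵇ_)
import Data.Nat.Properties as ℕ
open import Data.Nat.Divisibility using (_∣_; divides; ∣1⇒≡1; ∣m+n∣m⇒∣n; m∣m*n)
open import Data.Nat.Tactic.RingSolver using (solve-∀)
open import Data.Fin using (Fin; zero; suc; toℕ; fromℕ; inject₁; inject≤; splitAt; join; _↑ˡ_; _↑ʳ_; combine; quotient; remainder; _≟_)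
import Data.Fin.Properties as Fin
open import Data.Fin.Permutation.Components using (transpose; transpose-inverse)
open import Data.Bool using (Bool; true; false; _∧_; _∨_; not; T)
import Data.Bool.Properties as Bool
open import Data.Product using (Σ; ∃; ∃₂; ∃-syntax; _×_; _,_; proj₁; proj₂)
open import Data.Sum using (_⊎_; inj₁; inj₂; [_,_]′)
import Data.Sum.Effectful.Left as Sumₗ
open import Data.Vec.Functional using (_∷_)
open import Data.Empty using (⊥; ⊥-elim)
open import Function using (_∘_; id)
open import Function.Definitions using (Injective)
open import Level using (0ℓ)
open import Relation.Nullary using (¬_; Dec; yes; no; contradiction)
open import Relation.Nullary.Decidable using (⌊_⌋; dec-true; dec-false; isYes≗does; ¬?; _×-dec_)
open import Relation.Binary.PropositionalEquality

private
  variable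
    n m s t : ℕ

-- Containment of a cycle is never decided. A cycle that turns up acts like an exception instead: a
-- finite search either returns it or succeeds at every index.
∀-⊎ : ∀ {C : Set} {P : Fin n → Set} → (∀ i → C ⊎ P i) → C ⊎ (∀ i → P i)
∀-⊎ {C = C} = Fin.sequence (Sumₗ.applicative C 0ℓ)

-- Booleans and decidable equality

∧-true : ∀ {x y} → x ∧ y ≡ true → x ≡ true × y ≡ true
∧-true {true} {true} _ = refl , refl

∨-true : ∀ {x y} → x ∨ y ≡ true → x ≡ true ⊎ y ≡ true
∨-true {true}  _ = inj₁ refl
∨-true {false} e = inj₂ e

≟-true : {i j : Fin n} → ⌊ i ≟ j ⌋ ≡ true → i ≡ j
≟-true {i = i} {j} e with i ≟ j
... | yes i≡j = i≡j
≟-true () | no _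

≡⇒≟ : {i j : Fin n} → i ≡ j → ⌊ i ≟ j ⌋ ≡ true
≡⇒≟ {i = i} {j} i≡j = trans (isYes≗does (i ≟ j)) (dec-true (i ≟ j) i≡j)

⌊≟⌋-refl : (i : Fin n) → ⌊ i ≟ i ⌋ ≡ true
⌊≟⌋-refl i = ≡⇒≟ refl

⌊≟⌋-sym : (i j : Fin n) → ⌊ i ≟ j ⌋ ≡ ⌊ j ≟ i ⌋
⌊≟⌋-sym i j with i ≟ j | j ≟ i
... | yes _   | yes _   = refl
... | no _    | no _    = refl
... | yes i≡j | no j≢i  = contradiction (sym i≡j) j≢i
... | no i≢j  | yes j≡i = contradiction (sym j≡i) i≢j

≡ᵇ-true : ∀ {k l} → (k ≡ᵇ l) ≡ true → k ≡ l
≡ᵇ-true {k} {l} e = ℕ.≡ᵇ⇒≡ k l (subst T (sym e) _)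

≡ᵇ-refl : ∀ k → (k ≡ᵇ k) ≡ true
≡ᵇ-refl zero    = refl
≡ᵇ-refl (suc k) = ≡ᵇ-refl k

≡ᵇ-< : ∀ {k l} → k < l → (k ≡ᵇ l) ≡ false
≡ᵇ-< {k} {l} k<l with k ≡ᵇ l in e
... | false = refl
... | true  = contradiction (≡ᵇ-true e) (ℕ.<⇒≢ k<l)

-- Prescribing values of a permutation

transpose-left : (i j : Fin n) → transpose i j i ≡ j
transpose-left i j rewrite dec-true (i ≟ i) refl = refl

transpose-fixed : {i j k : Fin n} → k ≢ i → k ≢ j → transpose i j k ≡ k
transpose-fixed {i = i} {j} {k} k≢i k≢j
  rewrite dec-false (k ≟ i) k≢i | dec-false (k ≟ j) k≢j = refl

transpose-injective : (i j : Fin n) → Injective _≡_ _≡_ (transpose i j)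
transpose-injective i j {k} {l} e =
  trans (sym (transpose-inverse j i {k})) (trans (cong (transpose j i) e) (transpose-inverse j i {l}))

2-transitive : {a b i j : Fin n} → a ≢ b → i ≢ j →
  Σ (Fin n → Fin n) λ σ → Injective _≡_ _≡_ σ × σ a ≡ i × σ b ≡ j
2-transitive {a = a} {b} {i} {j} a≢b i≢j =
    transpose a i ∘ transpose b j′
  , (λ e → transpose-injective b j′ (transpose-injective a i e))
  , trans (cong (transpose a i) (transpose-fixed a≢b a≢j′)) (transpose-left a i)
  , trans (cong (transpose a i) (transpose-left b j′)) j′↦j
  where
  -- The preimage of `j` under `transpose a i`. Moving `b` there first leaves `a` alone, since `a`
  -- differs from `b` and from this preimage.
  j′ = transpose i a j
  j′↦j : transpose a i j′ ≡ j
  j′↦j = transpose-inverse a i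
  a≢j′ : a ≢ j′
  a≢j′ e = i≢j (trans (sym (transpose-left a i)) (trans (cong (transpose a i) e) j′↦j))

-- Paths and cycles

record Path {n} (G : Graph n) (t : ℕ) (x y : Fin n) : Set where
  field
    at        : Fin (suc t) → Fin n
    injective : Injective _≡_ _≡_ at
    step      : ∀ k → G (at (inject₁ k)) (at (suc k)) ≡ true
    start     : at zero ≡ x
    end       : at (fromℕ t) ≡ y

∷-injective : {v : Fin n} {f : Fin m → Fin n} → (∀ k → f k ≢ v) →
  Injective _≡_ _≡_ f → Injective _≡_ _≡_ (v ∷ f)
∷-injective v∉f inj {zero}  {zero}  e = refl
∷-injective v∉f inj {zero}  {suc l} e = contradiction (sym e) (v∉f l)
∷-injective v∉f inj {suc k} {zero}  e = contradiction e (v∉f k)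
∷-injective v∉f inj {suc k} {suc l} e = cong suc (inj e)

prepend : {G : Graph n} {x y v : Fin n} (p : Path G t x y) →
  (∀ k → Path.at p k ≢ v) → G v x ≡ true → Path G (suc t) v y
prepend {G = G} {v = v} p v∉p vx = record
  { at        = v ∷ at
  ; injective = ∷-injective v∉p injective
  ; step      = λ { zero → trans (cong (G v) start) vx ; (suc k) → step k }
  ; start     = refl
  ; end       = end
  }
  where open Path p

close : {G : Graph n} {x y : Fin n} → IsSimple G → Path G t x y → G y x ≡ true →
  Contains G (cycle (suc t))
close {t = t} {G = G} (G-sym , _) p yx = at , injective , adj
  where
  open Path p
  next-adj : ∀ a b → toℕ b ≡ next (suc t) a → G (at a) (at b) ≡ true
  next-adj a b e with toℕ a ≡ᵇ t in eq
  -- The wrap-around edge from the last vertex to the first is the only one that is not a step of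
  -- the path.
  next-adj a zero e | true
    rewrite Fin.toℕ-injective {i = a} {j = fromℕ t} (trans (≡ᵇ-true eq) (sym (Fin.toℕ-fromℕ t)))
    = trans (cong₂ G end start) yx
  next-adj a (suc b) e | false
    rewrite Fin.toℕ-injective {i = a} {j = inject₁ b} (trans (ℕ.suc-injective (sym e)) (sym (Fin.toℕ-inject₁ b)))
    = step b
  adj : ∀ a b → cycle (suc t) a b ≡ true → G (at a) (at b) ≡ true
  adj a b e with ∨-true (proj₂ (∧-true {not (toℕ a ≡ᵇ toℕ b)} e))
  ... | inj₁ e₁ = next-adj a b (≡ᵇ-true e₁)
  ... | inj₂ e₂ = trans (G-sym (at a) (at b)) (next-adj b a (≡ᵇ-true e₂))

cycle-step : (k : Fin t) → cycle (suc t) (inject₁ k) (suc k) ≡ true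
cycle-step {t} k
  rewrite Fin.toℕ-inject₁ k | ≡ᵇ-< (ℕ.n<1+n (toℕ k)) | ≡ᵇ-< (Fin.toℕ<n k) | ≡ᵇ-refl (toℕ k) = refl

-- Cliques

record Clique {n} (G : Graph n) (s : ℕ) : Set where
  field
    vertex    : Fin s → Fin n
    injective : Injective _≡_ _≡_ vertex
    adjacent  : ∀ {i j} → i ≢ j → G (vertex i) (vertex j) ≡ true

open Clique using (vertex)

infix 4 _∈_ _∉_

_∈_ _∉_ : {G : Graph n} → Fin n → Clique G s → Set
x ∈ K = ∃ λ i → vertex K i ≡ x
x ∉ K = ¬ (x ∈ K)

_∈?_ : {G : Graph n} (x : Fin n) (K : Clique G s) → Dec (x ∈ K)
x ∈? K = Fin.any? λ i → vertex K i ≟ x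

Disjoint : {G : Graph n} → Clique G s → Clique G t → Set
Disjoint A B = ∀ {x} → x ∈ A → x ∉ B

clique-adjacent : {G : Graph n} (K : Clique G s) {x y : Fin n} → x ∈ K → y ∈ K → x ≢ y → G x y ≡ true
clique-adjacent K (i , refl) (j , refl) x≢y = Clique.adjacent K (x≢y ∘ cong (vertex K))

reindex : {G : Graph n} (K : Clique G t) (σ : Fin s → Fin t) → Injective _≡_ _≡_ σ → Clique G s
reindex K σ inj = record
  { vertex    = vertex K ∘ σ
  ; injective = inj ∘ injective
  ; adjacent  = λ i≢j → adjacent (i≢j ∘ inj)
  }
  where open Clique K

-- The bridge of the dumbbell is attached at label zero, so a transposition of labels puts `x` there
-- while surplus vertices are dropped.
subclique : {G : Graph n} (K : Clique G t) {x : Fin n} → x ∈ K → suc s ≤ t →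
  Σ (Clique G (suc s)) λ K′ → vertex K′ zero ≡ x × (∀ {y} → y ∈ K′ → y ∈ K)
subclique {t = t} {s = s} K (i , refl) s<t =
    reindex K σ (λ e → Fin.inject≤-injective s<t s<t _ _ (transpose-injective _ i e))
  , cong (vertex K) (transpose-left (inject≤ zero s<t) i)
  , λ { (j , e) → σ j , e }
  where
  σ : Fin (suc s) → Fin t
  σ j = transpose (inject≤ zero s<t) i (inject≤ j s<t)

-- Any enumeration of vertices of a clique is a path. It remains to permute the labels so that the
-- first and the last of the `2 + t` retained ones name `x` and `y`.
clique-path : {G : Graph n} (K : Clique G s) {x y : Fin n} → x ∈ K → y ∈ K → x ≢ y → 2 + t ≤ s →
  Σ (Path G (suc t) x y) λ p → ∀ k → Path.at p k ∈ K
clique-path {s = s} {t = t} K (i , refl) (j , refl) x≢y t≤s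
  with 2-transitive {a = inject≤ zero t≤s} {inject≤ (fromℕ (suc t)) t≤s} {i} {j}
         (λ e → contradiction (Fin.inject≤-injective t≤s t≤s zero (suc (fromℕ t)) e) λ ())
         (x≢y ∘ cong (vertex K))
... | σ , σ-inj , σa≡i , σb≡j = record
  { at        = vertex K′
  ; injective = Clique.injective K′
  ; step      = λ k → Clique.adjacent K′ (inject₁≢suc k)
  ; start     = cong (vertex K) σa≡i
  ; end       = cong (vertex K) σb≡j
  } , λ k → σ (inject≤ k t≤s) , refl
  where
  K′ = reindex K (λ k → σ (inject≤ k t≤s)) (λ e → Fin.inject≤-injective t≤s t≤s _ _ (σ-inj e))
  inject₁≢suc : ∀ {l} (k : Fin l) → inject₁ k ≢ suc k
  inject₁≢suc k e = ℕ.1+n≢n (trans (sym (cong toℕ e)) (Fin.toℕ-inject₁ k))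

-- The dumbbell

-- With `suc s` vertices on each side there is always a label zero for the bridge. The clique size
-- called s in the overview is `suc s` here.
dumbbell-adj : Fin (suc s) ⊎ Fin (suc s) → Fin (suc s) ⊎ Fin (suc s) → Bool
dumbbell-adj (inj₁ i) (inj₁ j) = not ⌊ i ≟ j ⌋
dumbbell-adj (inj₂ i) (inj₂ j) = not ⌊ i ≟ j ⌋
dumbbell-adj (inj₁ i) (inj₂ j) = ⌊ i ≟ zero ⌋ ∧ ⌊ j ≟ zero ⌋
dumbbell-adj (inj₂ i) (inj₁ j) = ⌊ i ≟ zero ⌋ ∧ ⌊ j ≟ zero ⌋

dumbbell : (s : ℕ) → Graph (suc s + suc s)
dumbbell s a b = dumbbell-adj (splitAt (suc s) a) (splitAt (suc s) b)

dumbbell-simple : (s : ℕ) → IsSimple (dumbbell s)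
dumbbell-simple s = (λ a b → adj-sym (splitAt (suc s) a) (splitAt (suc s) b)) , λ a → adj-irrefl (splitAt (suc s) a)
  where
  adj-sym : (x y : Fin (suc s) ⊎ Fin (suc s)) → dumbbell-adj x y ≡ dumbbell-adj y x
  adj-sym (inj₁ i) (inj₁ j) = cong not (⌊≟⌋-sym i j)
  adj-sym (inj₂ i) (inj₂ j) = cong not (⌊≟⌋-sym i j)
  adj-sym (inj₁ i) (inj₂ j) = Bool.∧-comm ⌊ i ≟ zero ⌋ _
  adj-sym (inj₂ i) (inj₁ j) = Bool.∧-comm ⌊ i ≟ zero ⌋ _
  adj-irrefl : (x : Fin (suc s) ⊎ Fin (suc s)) → dumbbell-adj x x ≡ false
  adj-irrefl (inj₁ i) = cong not (⌊≟⌋-refl i)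
  adj-irrefl (inj₂ i) = cong not (⌊≟⌋-refl i)

not-≟-true : {i j : Fin n} → not ⌊ i ≟ j ⌋ ≡ true → i ≢ j
not-≟-true {i = i} e refl with () ← trans (sym e) (cong not (⌊≟⌋-refl i))

≢⇒not-≟ : {i j : Fin n} → i ≢ j → not ⌊ i ≟ j ⌋ ≡ true
≢⇒not-≟ {i = i} {j} i≢j = cong not (trans (isYes≗does (i ≟ j)) (dec-false (i ≟ j) i≢j))

splitAt-injective : ∀ k {l} {a b : Fin (k + l)} → splitAt k a ≡ splitAt k b → a ≡ b
splitAt-injective k {l} {a} {b} e =
  trans (sym (Fin.join-splitAt k l a)) (trans (cong (join k l) e) (Fin.join-splitAt k l b))

dumbbell⁺ : {G : Graph n} → IsSimple G → (A B : Clique G (suc s)) → Disjoint A B →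
  G (vertex A zero) (vertex B zero) ≡ true → Contains G (dumbbell s)
dumbbell⁺ {s = s} {G = G} (G-sym , _) A B A∩B=∅ ab =
    place ∘ splitAt (suc s)
  , (λ e → splitAt-injective (suc s) (place-injective _ _ e))
  , λ a b → place-adj (splitAt (suc s) a) (splitAt (suc s) b)
  where
  place = [ vertex A , vertex B ]′
  place-injective : ∀ x y → place x ≡ place y → x ≡ y
  place-injective (inj₁ i) (inj₁ j) e = cong inj₁ (Clique.injective A e)
  place-injective (inj₂ i) (inj₂ j) e = cong inj₂ (Clique.injective B e)
  place-injective (inj₁ i) (inj₂ j) e = contradiction (j , sym e) (A∩B=∅ (i , refl))
  place-injective (inj₂ i) (inj₁ j) e = contradiction (i , e) (A∩B=∅ (j , refl))
  place-adj : ∀ x y → dumbbell-adj x y ≡ true → G (place x) (place y) ≡ true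
  place-adj (inj₁ i) (inj₁ j) e = Clique.adjacent A (not-≟-true e)
  place-adj (inj₂ i) (inj₂ j) e = Clique.adjacent B (not-≟-true e)
  place-adj (inj₁ i) (inj₂ j) e with ∧-true {⌊ i ≟ zero ⌋} e
  ... | i≟0 , j≟0 rewrite ≟-true {i = i} i≟0 | ≟-true {i = j} j≟0 = ab
  place-adj (inj₂ i) (inj₁ j) e with ∧-true {⌊ i ≟ zero ⌋} e
  ... | i≟0 , j≟0 rewrite ≟-true {i = i} i≟0 | ≟-true {i = j} j≟0 = trans (G-sym _ _) ab

dumbbell⁻ : {G : Graph n} → Contains G (dumbbell s) →
  ∃₂ λ (A B : Clique G (suc s)) → Disjoint A B × G (vertex A zero) (vertex B zero) ≡ true
dumbbell⁻ {n} {s} {G} (f , f-inj , f-adj) = A , B , disjoint , f-adj zero (suc s ↑ʳ zero) bridge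
  where
  A : Clique G (suc s)
  A = record
    { vertex    = λ i → f (i ↑ˡ suc s)
    ; injective = λ e → Fin.↑ˡ-injective (suc s) _ _ (f-inj e)
    ; adjacent  = λ {i} {j} i≢j → f-adj _ _
        (trans (cong₂ dumbbell-adj (Fin.splitAt-↑ˡ (suc s) i (suc s)) (Fin.splitAt-↑ˡ (suc s) j (suc s))) (≢⇒not-≟ i≢j))
    }
  B : Clique G (suc s)
  B = record
    { vertex    = λ i → f (suc s ↑ʳ i)
    ; injective = λ e → Fin.↑ʳ-injective (suc s) _ _ (f-inj e)
    ; adjacent  = λ {i} {j} i≢j → f-adj _ _
        (trans (cong₂ dumbbell-adj (Fin.splitAt-↑ʳ (suc s) (suc s) i) (Fin.splitAt-↑ʳ (suc s) (suc s) j)) (≢⇒not-≟ i≢j))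
    }
  disjoint : Disjoint A B
  disjoint (i , refl) (j , e)
    with () ← trans (sym (Fin.splitAt-↑ʳ (suc s) (suc s) j))
                    (trans (cong (splitAt (suc s)) (f-inj e)) (Fin.splitAt-↑ˡ (suc s) i (suc s)))
  bridge : dumbbell s zero (suc s ↑ʳ zero) ≡ true
  bridge = cong (dumbbell-adj (inj₁ zero)) (Fin.splitAt-↑ʳ (suc s) (suc s) zero)

bridge⇒dumbbell : {G : Graph n} → IsSimple G → (A B : Clique G t) → suc s ≤ t → Disjoint A B →
  ∀ {u v} → u ∈ A → v ∈ B → G u v ≡ true → Contains G (dumbbell s)
bridge⇒dumbbell {G = G} simple A B s<t A∩B=∅ u∈A v∈B uv
  with subclique A u∈A s<t | subclique B v∈B s<t
... | A′ , A′0 , A′⊆A | B′ , B′0 , B′⊆B =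
  dumbbell⁺ simple A′ B′ (λ x∈A′ x∈B′ → A∩B=∅ (A′⊆A x∈A′) (B′⊆B x∈B′)) (trans (cong₂ G A′0 B′0) uv)

-- Adding an edge

module _ (G : Graph n) (u v : Fin n) where

  addEdge⁻ : ∀ {a b} → addEdge G u v a b ≡ true → G a b ≡ true ⊎ (a ≡ u × b ≡ v) ⊎ (a ≡ v × b ≡ u)
  addEdge⁻ {a} {b} e with ∨-true {G a b} e
  ... | inj₁ ab = inj₁ ab
  ... | inj₂ e′ with ∨-true {⌊ a ≟ u ⌋ ∧ ⌊ b ≟ v ⌋} e′
  ...   | inj₁ p with ∧-true {⌊ a ≟ u ⌋} p
  ...     | p₁ , p₂ = inj₂ (inj₁ (≟-true p₁ , ≟-true p₂))
  addEdge⁻ {a} {b} e | inj₂ e′ | inj₂ p with ∧-true {⌊ a ≟ v ⌋} p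
  ...     | p₁ , p₂ = inj₂ (inj₂ (≟-true p₁ , ≟-true p₂))

  addEdge-old : ∀ {a b} → G a b ≡ true → addEdge G u v a b ≡ true
  addEdge-old ab rewrite ab = refl

  addEdge-new : addEdge G u v u v ≡ true
  addEdge-new rewrite ⌊≟⌋-refl u | ⌊≟⌋-refl v = Bool.∨-zeroʳ (G u v)

  addEdge-simple : u ≢ v → IsSimple G → IsSimple (addEdge G u v)
  addEdge-simple u≢v (G-sym , G-irrefl) = add-sym , add-irrefl
    where
    add-sym : ∀ a b → addEdge G u v a b ≡ addEdge G u v b a
    add-sym a b = cong₂ _∨_ (G-sym a b)
      (trans (Bool.∨-comm (⌊ a ≟ u ⌋ ∧ ⌊ b ≟ v ⌋) _)
             (cong₂ _∨_ (Bool.∧-comm ⌊ a ≟ v ⌋ _) (Bool.∧-comm ⌊ a ≟ u ⌋ _)))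
    add-irrefl : ∀ a → addEdge G u v a a ≡ false
    add-irrefl a with addEdge G u v a a in e
    ... | false = refl
    ... | true with addEdge⁻ e
    ...   | inj₁ aa              = trans (sym aa) (G-irrefl a)
    ...   | inj₂ (inj₁ (p , q)) = contradiction (trans (sym p) q) u≢v
    ...   | inj₂ (inj₂ (p , q)) = contradiction (trans (sym q) p) u≢v

  addEdge-clique : Clique G s → Clique (addEdge G u v) s
  addEdge-clique K = record
    { vertex = vertex K ; injective = Clique.injective K ; adjacent = addEdge-old ∘ Clique.adjacent K }

-- Disjoint unions of cliques of equal size

blocks : (k t : ℕ) → Graph (k * t)
blocks k t a b = ⌊ quotient {k} t a ≟ quotient {k} t b ⌋ ∧ not ⌊ a ≟ b ⌋

module _ (k t : ℕ) where

  private
    block : Fin (k * t) → Fin k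
    block = quotient {k} t

  blocks-simple : IsSimple (blocks k t)
  blocks-simple =
      (λ a b → cong₂ _∧_ (⌊≟⌋-sym (block a) (block b)) (cong not (⌊≟⌋-sym a b)))
    , λ a → trans (cong (⌊ block a ≟ block a ⌋ ∧_) (cong not (⌊≟⌋-refl a))) (Bool.∧-zeroʳ ⌊ block a ≟ block a ⌋)

  blocks⁻ : ∀ {a b} → blocks k t a b ≡ true → block a ≡ block b
  blocks⁻ {a} {b} e = ≟-true (proj₁ (∧-true {⌊ block a ≟ block b ⌋} e))

  -- Inside one block the remainder identifies a vertex. Hence a connected graph on more than `t`
  -- vertices does not embed, which is how both freeness lemmas below argue.
  one-block⇒≤ : (f : Fin m → Fin (k * t)) → Injective _≡_ _≡_ f →
    (∀ i j → block (f i) ≡ block (f j)) → m ≤ t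
  one-block⇒≤ f f-inj same = Fin.injective⇒≤ {f = remainder {k} t ∘ f} λ {i} {j} e → f-inj
    (trans (sym (Fin.combine-remQuot {k} t (f i)))
      (trans (cong₂ combine (same i j) e) (Fin.combine-remQuot {k} t (f j))))

  block-clique : Fin k → Clique (blocks k t) t
  block-clique q = record
    { vertex    = combine q
    ; injective = λ {i} {j} e → Fin.combine-injectiveʳ q i q j e
    ; adjacent  = λ {i} {j} i≢j → cong₂ _∧_
        (≡⇒≟
          (trans (cong proj₁ (Fin.remQuot-combine q i)) (sym (cong proj₁ (Fin.remQuot-combine q j)))))
        (≢⇒not-≟ (i≢j ∘ Fin.combine-injectiveʳ q i q j))
    }

  ∈-block-clique : ∀ a → a ∈ block-clique (block a)
  ∈-block-clique a = remainder {k} t a , Fin.combine-remQuot {k} t a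

  block-clique-disjoint : ∀ {p q} → p ≢ q → Disjoint (block-clique p) (block-clique q)
  block-clique-disjoint {p} {q} p≢q (i , refl) (j , e) = p≢q (sym (Fin.combine-injectiveˡ q j p i e))

  -- The dumbbell is connected: every vertex reaches `hub₁` through the hub of its own side. Its
  -- image would therefore lie in a single block.
  blocks-dumbbell-free : t < suc s + suc s → ¬ Contains (blocks k t) (dumbbell s)
  blocks-dumbbell-free {s} t<2s (f , f-inj , f-adj) =
    ℕ.<⇒≱ t<2s (one-block⇒≤ f f-inj λ a b → trans (same a) (sym (same b)))
    where
    linked : ∀ a b → dumbbell s a b ≡ true → block (f a) ≡ block (f b)
    linked a b e = blocks⁻ (f-adj a b e)
    hub₁ hub₂ : Fin (suc s + suc s)
    hub₁ = zero
    hub₂ = suc s ↑ʳ zero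
    split-hub₂ = Fin.splitAt-↑ʳ (suc s) (suc s) zero
    same : ∀ a → block (f a) ≡ block (f hub₁)
    same a with splitAt (suc s) a in e
    ... | inj₁ zero    = cong (block ∘ f) (splitAt-injective (suc s) e)
    ... | inj₁ (suc i) = linked a hub₁ (cong (λ x → dumbbell-adj x (inj₁ zero)) e)
    ... | inj₂ zero    = linked a hub₁ (cong (λ x → dumbbell-adj x (inj₁ zero)) e)
    ... | inj₂ (suc i) = trans
      (linked a hub₂ (cong₂ dumbbell-adj e split-hub₂))
      (linked hub₂ hub₁ (cong (λ x → dumbbell-adj x (inj₁ zero)) split-hub₂))

  blocks-cycle-free : ∀ {l} → t < suc l → ¬ Contains (blocks k t) (cycle (suc l))
  blocks-cycle-free {l} t<1+l (f , f-inj , f-adj) =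
    ℕ.<⇒≱ t<1+l (one-block⇒≤ f f-inj λ a b → trans (same f step a) (sym (same f step b)))
    where
    step : ∀ i → block (f (inject₁ i)) ≡ block (f (suc i))
    step i = blocks⁻ (f-adj _ _ (cycle-step i))
    -- General in `f`, so that the induction can drop the first vertex.
    same : ∀ {l} (f : Fin (suc l) → Fin (k * t)) → (∀ i → block (f (inject₁ i)) ≡ block (f (suc i))) →
      ∀ a → block (f a) ≡ block (f zero)
    same f st zero = refl
    same {suc l} f st (suc a) = trans (same (f ∘ suc) (st ∘ suc) a) (sym (st zero))

  -- Distinct non-adjacent vertices lie in different blocks, so the new edge bridges two disjoint
  -- cliques that are large enough.
  blocks-saturated : suc s ≤ t → t < suc s + suc s → Saturated (blocks k t) (dumbbell s)
  blocks-saturated {s} s<t t<2s = blocks-dumbbell-free t<2s , λ u v u≢v ¬uv →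
    let u≁v : block u ≢ block v
        u≁v e = contradiction
          (trans (sym (cong₂ _∧_ (≡⇒≟ e) (≢⇒not-≟ u≢v))) ¬uv) λ ()
    in bridge⇒dumbbell (addEdge-simple (blocks k t) u v u≢v blocks-simple)
         (addEdge-clique _ u v (block-clique (block u))) (addEdge-clique _ u v (block-clique (block v)))
         s<t (block-clique-disjoint u≁v) (∈-block-clique u) (∈-block-clique v) (addEdge-new (blocks k t) u v)

-- Partitions into blocks of equal size

BlockWithin : (Fin n → Fin s → Fin n) → Fin n → Fin n → Set
BlockWithin K x y = ∀ k → ∃ λ l → K y l ≡ K x k

-- Greedily pick representatives c of pairwise disjoint blocks until they cover Fin n.
partition⇒∣ : (K : Fin n → Fin (suc s) → Fin n) →
  (∀ x → Injective _≡_ _≡_ (K x)) → (∀ x → ∃ λ i → K x i ≡ x) →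
  (∀ {x y i j} → K x i ≡ K y j → BlockWithin K x y) → suc s ∣ n
partition⇒∣ {n} {s} K K-inj K-self K-same = grow n zero (λ ()) (λ ()) ℕ.≤-refl
  where
  JointlyInjective : ∀ {k} → (Fin k → Fin n) → Set
  JointlyInjective {k} c = ∀ a i b j → K (c a) i ≡ K (c b) j → a ≡ b × i ≡ j

  disjoint-blocks⇒≤ : ∀ {k} (c : Fin k → Fin n) → JointlyInjective c → k * suc s ≤ n
  disjoint-blocks⇒≤ {k} c c-inj =
    Fin.injective⇒≤ {f = λ z → K (c (quotient {k} (suc s) z)) (remainder {k} (suc s) z)} λ {y} {z} e →
      let p , q = c-inj _ _ _ _ e
      in trans (sym (Fin.combine-remQuot {k} (suc s) y)) (trans (cong₂ combine p q) (Fin.combine-remQuot {k} (suc s) z))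

  -- `fuel` bounds the number of uncovered vertices, and each new block costs one unit. When it runs
  -- out, counting forces the blocks to cover everything.
  grow : ∀ fuel k (c : Fin k → Fin n) → JointlyInjective c → n ≤ k * suc s + fuel → suc s ∣ n
  grow zero k c c-inj n≤ =
    divides k (ℕ.≤-antisym (subst (n ≤_) (ℕ.+-identityʳ _) n≤) (disjoint-blocks⇒≤ c c-inj))
  grow (suc fuel) k c c-inj n≤
    with Fin.any? (λ x → ¬? (Fin.any? λ a → Fin.any? λ i → K (c a) i ≟ x))
  ... | yes (x , x-new) = grow fuel (suc k) (x ∷ c) x∷c-inj n≤′
    where
    -- Meeting an old block would put the whole block of `x` inside it, and with it `x`, which was
    -- uncovered.
    meets : ∀ {i b j} → K x i ≡ K (c b) j → ⊥
    meets {i} {b} {j} e with K-self x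
    ... | i₀ , e₀ with K-same e i₀
    ...   | l , e₁ = x-new (b , l , trans e₁ e₀)
    x∷c-inj : JointlyInjective (x ∷ c)
    x∷c-inj zero    i zero    j e = refl , K-inj x e
    x∷c-inj zero    i (suc b) j e = ⊥-elim (meets e)
    x∷c-inj (suc a) i zero    j e = ⊥-elim (meets (sym e))
    x∷c-inj (suc a) i (suc b) j e with c-inj a i b j e
    ... | p , q = cong suc p , q
    n≤′ : n ≤ suc k * suc s + fuel
    n≤′ = ℕ.≤-trans n≤ (ℕ.≤-trans (ℕ.≤-reflexive (ℕ.+-suc _ fuel))
      (s≤s (ℕ.+-monoˡ-≤ fuel (ℕ.m≤n+m (k * suc s) s))))
  ... | no ¬new = divides k (ℕ.≤-antisym n≤ks (disjoint-blocks⇒≤ c c-inj))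
    where
    old : ∀ x → ∃ λ a → ∃ λ i → K (c a) i ≡ x
    old x with Fin.any? (λ a → Fin.any? λ i → K (c a) i ≟ x)
    ... | yes p = p
    ... | no ¬p = contradiction (x , ¬p) ¬new
    n≤ks : n ≤ k * suc s
    n≤ks = Fin.injective⇒≤ {f = λ x → combine (proj₁ (old x)) (proj₁ (proj₂ (old x)))} λ {x} {y} e →
      let p , q = Fin.combine-injective (proj₁ (old x)) (proj₁ (proj₂ (old x))) _ _ e
      in trans (sym (proj₂ (proj₂ (old x)))) (trans (cong₂ (λ a → K (c a)) p q) (proj₂ (proj₂ (old y))))

-- Saturated graphs

module _ (p : ℕ) {n} (G : Graph n) (simple : IsSimple G) where

  private
    size = 4 + p

    C : Set
    C = Contains G (cycle (suc size))

    G-sym : ∀ {x y} → G x y ≡ true → G y x ≡ true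
    G-sym {x} {y} xy = trans (proj₁ simple y x) xy

    G-irrefl : ∀ {x y} → G x y ≡ true → x ≢ y
    G-irrefl {x} xx refl with () ← trans (sym xx) (proj₂ simple x)

    ∈∉⇒≢ : {K : Clique G size} {x y : Fin n} → x ∈ K → y ∉ K → x ≢ y
    ∈∉⇒≢ x∈K y∉K refl = y∉K x∈K

  -- The subscript here and below counts the vertices outside `K`. With i of them, the part inside
  -- `K` has `suc size` minus i vertices, which fixes the choice of `t`.
  cycle-via₁ : (K : Clique G size) {a b x : Fin n} → a ∈ K → b ∈ K → a ≢ b →
    x ∉ K → G x a ≡ true → G x b ≡ true → C
  cycle-via₁ K a∈K b∈K a≢b x∉K xa xb with clique-path {t = 2 + p} K a∈K b∈K a≢b ℕ.≤-refl
  ... | π , π⊆K = close simple (prepend π (λ k → ∈∉⇒≢ {K} (π⊆K k) x∉K) xa) (G-sym xb)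

  cycle-via₂ : (K : Clique G size) {a b x q : Fin n} → a ∈ K → b ∈ K → a ≢ b →
    x ∉ K → q ∉ K → G x a ≡ true → G q x ≡ true → G q b ≡ true → C
  cycle-via₂ K a∈K b∈K a≢b x∉K q∉K xa qx qb
    with clique-path {t = 1 + p} K a∈K b∈K a≢b (ℕ.n≤1+n _)
  ... | π , π⊆K = close simple
    (prepend (prepend π (λ k → ∈∉⇒≢ {K} (π⊆K k) x∉K) xa)
      (λ { zero → G-irrefl (G-sym qx) ; (suc k) → ∈∉⇒≢ {K} (π⊆K k) q∉K }) qx)
    (G-sym qb)

  -- The part inside `K` has `2 + p` vertices, for p = 0 just the edge `ab`. A clique on three
  -- vertices would leave no room for both ends.
  cycle-via₃ : (K : Clique G size) {a b q x q′ : Fin n} → a ∈ K → b ∈ K → a ≢ b →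
    q ∉ K → x ∉ K → q′ ∉ K → q ≢ q′ →
    G q a ≡ true → G x q ≡ true → G x q′ ≡ true → G q′ b ≡ true → C
  cycle-via₃ K a∈K b∈K a≢b q∉K x∉K q′∉K q≢q′ qa xq xq′ q′b
    with clique-path {t = p} K a∈K b∈K a≢b (ℕ.≤-trans (ℕ.n≤1+n _) (ℕ.n≤1+n _))
  ... | π , π⊆K = close simple
    (prepend
      (prepend (prepend π (λ k → ∈∉⇒≢ {K} (π⊆K k) q∉K) qa)
        (λ { zero → G-irrefl (G-sym xq) ; (suc k) → ∈∉⇒≢ {K} (π⊆K k) x∉K }) xq)
      (λ { zero → G-irrefl xq′ ; (suc zero) → q≢q′ ; (suc (suc k)) → ∈∉⇒≢ {K} (π⊆K k) q′∉K })
      (G-sym xq′))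
    (G-sym q′b)

  CommonNeighbour : Fin n → Fin n → Fin n → Set
  CommonNeighbour x y q = G x q ≡ true × G y q ≡ true

  -- Encoded as a common neighbour distinct from any prescribed vertex z.
  TwoCommonNeighbours : Fin n → Fin n → Set
  TwoCommonNeighbours x y = ∀ z → ∃ λ q → q ≢ z × CommonNeighbour x y q

  -- Unless `K` uses both ends of the new edge, all its edges are old. Otherwise each of its
  -- remaining vertices, at least two, is a common neighbour of `x` and `y` in `G`. The equation
  -- between vertex maps lets disjointness pass back to `G`.
  clique-addEdge⁻ : ∀ {x y} (K : Clique (addEdge G x y) size) →
    (Σ (Clique G size) λ K′ → vertex K′ ≡ vertex K) ⊎ (x ∈ K × TwoCommonNeighbours x y)
  clique-addEdge⁻ {x} {y} K with (x ∈? K) ×-dec (y ∈? K)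
  ... | no ¬both = inj₁ (K′ , refl)
    where
    adj : ∀ {i j} → G (vertex K i) (vertex K j) ≡ true ⊎ (vertex K i ≡ x × vertex K j ≡ y) ⊎ (vertex K i ≡ y × vertex K j ≡ x) →
      G (vertex K i) (vertex K j) ≡ true
    adj (inj₁ ij)                      = ij
    adj {i} {j} (inj₂ (inj₁ (e , e′))) = contradiction ((i , e) , (j , e′)) ¬both
    adj {i} {j} (inj₂ (inj₂ (e , e′))) = contradiction ((j , e′) , (i , e)) ¬both
    K′ : Clique G size
    K′ = record { vertex = vertex K ; injective = Clique.injective K
                ; adjacent = adj ∘ addEdge⁻ G x y ∘ Clique.adjacent K }
  ... | yes (x∈K , y∈K) = inj₂ (x∈K , common)
    where
    old : ∀ {q} → q ∈ K → q ≢ x → q ≢ y → CommonNeighbour x y q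
    old {q} q∈K q≢x q≢y = pick (addEdge⁻ G x y (clique-adjacent K x∈K q∈K (q≢x ∘ sym)))
                    , pick (addEdge⁻ G x y (clique-adjacent K y∈K q∈K (q≢y ∘ sym)))
      where
      pick : ∀ {w} → G w q ≡ true ⊎ (w ≡ x × q ≡ y) ⊎ (w ≡ y × q ≡ x) → G w q ≡ true
      pick (inj₁ wq)             = wq
      pick (inj₂ (inj₁ (_ , e))) = contradiction e q≢y
      pick (inj₂ (inj₂ (_ , e))) = contradiction e q≢x
    common : TwoCommonNeighbours x y
    common z with Fin.any? (λ k → ¬? (vertex K k ≟ z) ×-dec (¬? (vertex K k ≟ x) ×-dec ¬? (vertex K k ≟ y)))
    ... | yes (k , k≢z , k≢x , k≢y) = vertex K k , k≢z , old (k , refl) k≢x k≢y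
    -- Pigeonhole: the at least four vertices of `K` would all be among `z`, `x` and `y`.
    ... | no none = contradiction (Fin.injective⇒≤ {f = name} name-injective) (ℕ.<⇒≱ (s≤s (s≤s (s≤s (s≤s z≤n)))))
      where
      named : ∀ k → ∃ λ (c : Fin 3) → vertex K k ≡ (z ∷ x ∷ y ∷ λ ()) c
      named k with vertex K k ≟ z | vertex K k ≟ x | vertex K k ≟ y
      ... | yes e | _     | _     = zero , e
      ... | no _  | yes e | _     = suc zero , e
      ... | no _  | no _  | yes e = suc (suc zero) , e
      ... | no a  | no b  | no c  = contradiction (k , a , b , c) none
      name : Fin size → Fin 3
      name = proj₁ ∘ named
      name-injective : Injective _≡_ _≡_ name
      name-injective {k} {l} e = Clique.injective K
        (trans (proj₂ (named k)) (trans (cong (z ∷ x ∷ y ∷ λ ()) e) (sym (proj₂ (named l)))))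

  -- Consequences of saturation

  module _ (saturated : Saturated G (dumbbell (3 + p))) where

    private
      no-dumbbell : (A B : Clique G size) → Disjoint A B → ∀ {u v} → u ∈ A → v ∈ B → G u v ≡ true → ⊥
      no-dumbbell A B A∩B=∅ u∈A v∈B uv =
        proj₁ saturated (bridge⇒dumbbell simple A B ℕ.≤-refl A∩B=∅ u∈A v∈B uv)

    -- The two sides of the new dumbbell are disjoint, so at most one contains `x`; the other is a
    -- clique of `G`.
    nonadjacent⇒clique : ∀ {x y} → x ≢ y → G x y ≡ false → Clique G size
    nonadjacent⇒clique {x} {y} x≢y ¬xy with dumbbell⁻ (proj₂ saturated x y x≢y ¬xy)
    ... | A , B , A∩B=∅ , _ with clique-addEdge⁻ A | clique-addEdge⁻ B
    ...   | inj₁ (K , _)   | _              = K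
    ...   | inj₂ _         | inj₁ (K , _)   = K
    ...   | inj₂ (x∈A , _) | inj₂ (x∈B , _) = contradiction x∈B (A∩B=∅ x∈A)

    -- If both sides of the new dumbbell are old cliques, the bridge must be the new edge, as `G`
    -- itself has no dumbbell. A side that uses the new edge yields the common neighbours.
    nonadjacent : ∀ {x y} → x ≢ y → G x y ≡ false →
      TwoCommonNeighbours x y ⊎ (∃₂ λ (A B : Clique G size) → Disjoint A B × x ∈ A × y ∈ B)
    nonadjacent {x} {y} x≢y ¬xy with dumbbell⁻ (proj₂ saturated x y x≢y ¬xy)
    ... | A , B , A∩B=∅ , ab with clique-addEdge⁻ A | clique-addEdge⁻ B
    ...   | inj₂ (_ , common) | _                 = inj₁ common
    ...   | inj₁ _            | inj₂ (_ , common) = inj₁ common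
    ...   | inj₁ (A′ , refl)  | inj₁ (B′ , refl) with addEdge⁻ G x y ab
    ...     | inj₁ ab′             = ⊥-elim (no-dumbbell A′ B′ A∩B=∅ (zero , refl) (zero , refl) ab′)
    ...     | inj₂ (inj₁ (e , e′)) = inj₂ (A′ , B′ , A∩B=∅ , (zero , e) , (zero , e′))
    ...     | inj₂ (inj₂ (e , e′)) = inj₂ (B′ , A′ , (λ b a → A∩B=∅ a b) , (zero , e′) , (zero , e))

    -- Without a non-adjacent pair the graph is complete on more than `size` vertices, so any
    -- placement of the cycle works.
    some-clique : size < n → C ⊎ Clique G size
    some-clique s<n with Fin.any? (λ x → Fin.any? λ y → ¬? (x ≟ y) ×-dec (G x y Bool.≟ false))
    ... | yes (x , y , x≢y , ¬xy) = inj₂ (nonadjacent⇒clique x≢y ¬xy)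
    ... | no complete = inj₁
      ( (λ i → inject≤ i s<n)
      , (λ e → Fin.inject≤-injective s<n s<n _ _ e)
      , λ a b ab → adj (cycle-irrefl ab ∘ Fin.inject≤-injective s<n s<n a b))
      where
      adj : ∀ {x y} → x ≢ y → G x y ≡ true
      adj {x} {y} x≢y with G x y in e
      ... | true  = refl
      ... | false = contradiction (x , y , x≢y , e) complete
      cycle-irrefl : ∀ {a b} → cycle (suc size) a b ≡ true → a ≢ b
      cycle-irrefl {a} e refl with () ← trans (sym (cong not (≡ᵇ-refl (toℕ a)))) (proj₁ (∧-true e))

    -- Apart from the disjoint cliques, every outcome is a detour around `K`. Either `x` has a
    -- second neighbour in `K`, namely `y` or `q`, or z, x, q, y is a path whose interior avoids
    -- `K`.
    attached : (K : Clique G size) {x z y : Fin n} → x ∉ K → z ∈ K → G x z ≡ true → y ∈ K → y ≢ z →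
      C ⊎ (G x y ≡ false × ∃₂ λ (A B : Clique G size) → Disjoint A B × x ∈ A × y ∈ B)
    attached K {x} {z} {y} x∉K z∈K xz y∈K y≢z with G x y in xy
    ... | true = inj₁ (cycle-via₁ K y∈K z∈K y≢z x∉K xy xz)
    ... | false with nonadjacent (∈∉⇒≢ {K} y∈K x∉K ∘ sym) xy
    ...   | inj₂ AB = inj₂ (refl , AB)
    ...   | inj₁ common with common z
    ...     | q , q≢z , xq , yq with q ∈? K
    ...       | yes q∈K = inj₁ (cycle-via₁ K q∈K z∈K q≢z x∉K xq xz)
    ...       | no q∉K  = inj₁ (cycle-via₂ K z∈K y∈K (y≢z ∘ sym) x∉K q∉K xz (G-sym xq) (G-sym yq))

    private
      other : (K : Clique G size) (z : Fin n) → ∃ λ y → y ∈ K × y ≢ z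
      other K z with vertex K zero ≟ z
      ... | no ≢z = vertex K zero , (zero , refl) , ≢z
      ... | yes refl = vertex K (suc zero) , (suc zero , refl) , λ e → contradiction (Clique.injective K e) λ ()

    -- If `x` has a neighbour in `K`, `attached` applies. If not, compare `x` with two vertices of
    -- `K`: common neighbours in both cases lie outside `K` and give a detour with one or three
    -- interior vertices.
    clique-through : Clique G size → ∀ x → C ⊎ (Σ (Clique G size) λ A → x ∈ A)
    clique-through K x with x ∈? K
    ... | yes x∈K = inj₂ (K , x∈K)
    ... | no x∉K with Fin.any? (λ i → G x (vertex K i) Bool.≟ true)
    ...   | yes (i , xz) with other K (vertex K i)
    ...     | y , y∈K , y≢z with attached K x∉K (i , refl) xz y∈K y≢z
    ...       | inj₁ c = inj₁ c
    ...       | inj₂ (_ , A , _ , _ , x∈A , _) = inj₂ (A , x∈A)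
    clique-through K x | no x∉K | no isolated
      with nonadjacent (x∉K ∘ (zero ,_) ∘ sym) (Bool.¬-not (isolated ∘ (zero ,_)))
         | nonadjacent (x∉K ∘ (suc zero ,_) ∘ sym) (Bool.¬-not (isolated ∘ (suc zero ,_)))
    ... | inj₂ (A , _ , _ , x∈A , _) | _ = inj₂ (A , x∈A)
    ... | inj₁ _ | inj₂ (A , _ , _ , x∈A , _) = inj₂ (A , x∈A)
    -- One common neighbour for each pair suffices, so the vertex to be avoided is chosen
    -- arbitrarily.
    ... | inj₁ common₀ | inj₁ common₁ with common₀ x | common₁ x
    ...   | q , _ , xq , k₀q | q′ , _ , xq′ , k₁q′ with q ≟ q′
    ...     | yes refl = inj₁ (cycle-via₁ K (zero , refl) (suc zero , refl) (λ e → contradiction (Clique.injective K e) λ ())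
                           (λ { (i , refl) → isolated (i , xq) }) (G-sym k₀q) (G-sym k₁q′))
    ...     | no q≢q′  = inj₁ (cycle-via₃ K (zero , refl) (suc zero , refl) (λ e → contradiction (Clique.injective K e) λ ())
                           (λ { (i , refl) → isolated (i , xq) }) x∉K (λ { (i , refl) → isolated (i , xq′) }) q≢q′
                           (G-sym k₀q) xq xq′ (G-sym k₁q′))

    -- Disjoint `A` and `K` would form a dumbbell with the edge `xz`. A shared vertex is a second
    -- neighbour of `x` in `K`, different from `z`.
    meeting-clique : (A K : Clique G size) {x z : Fin n} → x ∈ A → z ∉ A → x ∉ K → z ∈ K → G x z ≡ true → C
    meeting-clique A K {x} {z} x∈A z∉A x∉K z∈K xz with Fin.any? (λ i → vertex A i ∈? K)
    ... | yes (i , w∈K) = cycle-via₁ K w∈K z∈K (∈∉⇒≢ {A} (i , refl) z∉A) x∉K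
                            (clique-adjacent A x∈A (i , refl) (∈∉⇒≢ {K} w∈K x∉K ∘ sym)) xz
    ... | no disjoint = ⊥-elim (no-dumbbell A K (λ { (i , refl) w∈K → disjoint (i , w∈K) }) x∈A z∈K xz)

    -- Let `x` lie outside `K` and `y` in `K` with `y` different from `z`. Unless a cycle appears,
    -- disjoint cliques `A` and `B` pass through `x` and `y`, and `z` misses one of them. Then
    -- `meeting-clique` applies to `A` and `K` along `xz`, or to `B` and `K′` along `yz`.
    intersecting⇒⊆ : (K K′ : Clique G size) {z x : Fin n} → z ∈ K → z ∈ K′ → x ∈ K′ → C ⊎ (x ∈ K)
    intersecting⇒⊆ K K′ {z} {x} z∈K z∈K′ x∈K′ with x ∈? K
    ... | yes x∈K = inj₂ x∈K
    ... | no x∉K with other K z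
    ...   | y , y∈K , y≢z with attached K x∉K z∈K xz y∈K y≢z
      where
      xz : G x z ≡ true
      xz = clique-adjacent K′ x∈K′ z∈K′ (∈∉⇒≢ {K} z∈K x∉K ∘ sym)
    ...     | inj₁ c = inj₁ c
    ...     | inj₂ (¬xy , A , B , A∩B=∅ , x∈A , y∈B) with z ∈? A
    ...       | no z∉A = inj₁ (meeting-clique A K x∈A z∉A x∉K z∈K
                           (clique-adjacent K′ x∈K′ z∈K′ (∈∉⇒≢ {K} z∈K x∉K ∘ sym)))
    ...       | yes z∈A = inj₁ (meeting-clique B K′ y∈B (A∩B=∅ z∈A) y∉K′ z∈K′ (clique-adjacent K y∈K z∈K y≢z))
      where
      y∉K′ : y ∉ K′
      y∉K′ y∈K′ with () ← trans (sym ¬xy) (clique-adjacent K′ x∈K′ y∈K′ (∈∉⇒≢ {K} y∈K x∉K ∘ sym))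

    -- Pick a clique through every vertex. Picked cliques that meet have the same vertex set,
    -- possibly labelled differently, so they partition the vertices.
    cycle-or-∣ : size < n → C ⊎ (size ∣ n)
    cycle-or-∣ s<n with some-clique s<n
    ... | inj₁ c = inj₁ c
    ... | inj₂ K₀ with ∀-⊎ (clique-through K₀)
    ...   | inj₁ c = inj₁ c
    ...   | inj₂ cover with ∀-⊎ (λ x → ∀-⊎ (λ y → ∀-⊎ (λ i → ∀-⊎ (λ k → nested x y i k))))
      where
      K : Fin n → Clique G size
      K = proj₁ ∘ cover
      nested : ∀ x y i k → C ⊎ (vertex (K x) i ∈ K y → vertex (K x) k ∈ K y)
      nested x y i k with vertex (K x) i ∈? K y
      ... | no ∉Ky = inj₂ λ ∈Ky → contradiction ∈Ky ∉Ky
      ... | yes ∈Ky with intersecting⇒⊆ (K y) (K x) ∈Ky (i , refl) (k , refl)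
      ...   | inj₁ c = inj₁ c
      ...   | inj₂ r = inj₂ λ _ → r
    ...     | inj₁ c = inj₁ c
    ...     | inj₂ nested = inj₂ (partition⇒∣ (λ x → vertex (proj₁ (cover x))) (λ x → Clique.injective (proj₁ (cover x)))
                              (λ x → proj₂ (cover x)) (λ {x} {y} {i} {j} e k → nested x y i k (j , sym e)))

-- The two infinite families of orders

theorem1p10 : ∀ (r : ℕ) → 5 ≤ r →
    ∃[ m ] Σ (Graph m) λ F → IsSimple F ×
    InfinitelyMany (λ n → SatIsZero n (cycle r) F) ×
    InfinitelyMany (λ n → SatIsPositive n (cycle r) F)
theorem1p10 (suc (suc (suc (suc (suc p))))) (s≤s (s≤s (s≤s (s≤s (s≤s _))))) =
  size + size , dumbbell (3 + p) , dumbbell-simple (3 + p) , zeros , positives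
  where
  size = 4 + p
  s<2s : suc size < size + size
  s<2s = s≤s (s≤s (s≤s (s≤s (ℕ.≤-trans (ℕ.m≤n+m (2 + p) 2) (ℕ.m≤n+m (4 + p) p)))))

  zeros : InfinitelyMany (λ n → SatIsZero n (cycle (suc size)) (dumbbell (3 + p)))
  zeros N = N * size , ℕ.m≤m*n N size , blocks N size , blocks-simple N size ,
    blocks-saturated N size ℕ.≤-refl (ℕ.<-trans (ℕ.n<1+n size) s<2s) , blocks-cycle-free N size ℕ.≤-refl

  positives : InfinitelyMany (λ n → SatIsPositive n (cycle (suc size)) (dumbbell (3 + p)))
  positives N = k * suc size , N≤n ,
      (blocks k (suc size) , blocks-simple k (suc size) , blocks-saturated k (suc size) (ℕ.n≤1+n size) s<2s)
    , λ G simple saturated → [ id , (λ s∣n → contradiction s∣n s∤n) ]′ (cycle-or-∣ p G simple saturated s<n)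
    where
    -- Both `k` and `suc size` are 1 modulo `size`, hence so is the order `k * suc size`; `expand`
    -- exhibits the quotient.
    k = suc (N * size)
    N≤n : N ≤ k * suc size
    N≤n = ℕ.≤-trans (ℕ.m≤m*n N size) (ℕ.≤-trans (ℕ.n≤1+n _) (ℕ.m≤m*n k (suc size)))
    s<n : size < k * suc size
    s<n = ℕ.m≤m+n (suc size) (N * size * suc size)
    expand : ∀ N s → suc (N * s) * suc s ≡ s * (N * suc s + 1) + 1
    expand = solve-∀
    s∤n : ¬ (size ∣ k * suc size)
    s∤n s∣n with () ← ∣1⇒≡1 (∣m+n∣m⇒∣n (subst (size ∣_) (expand N size) s∣n) (m∣m*n (N * suc size + 1)))
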